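{- Let $r\geq 3$ and $n\geq r^2-3r+4$ be integers. Then in every edge coloring of $K_n^r$ with $r-2$ colors there is a monochromatic Hamiltonian Berge-cycle.
   Context: $K_n^r$ denotes the complete $r$-uniform hypergraph on $n$ vertices. A Hamiltonian Berge-cycle in an $r$-uniform hypergraph on $n$ vertices consists of an ordering $v_1,\dots,v_n$ of all vertices (the core sequence) together with distinct edges $e_1,\dots,e_n$ such that $e_j$ contains $v_j$ and $v_{j+1}$ (indices modulo $n$). It is monochromatic if all of $e_1,\dots,e_n$ have the same color. -}

module Defs where

open import Data.Nat using (ℕ; zero; suc; _+_; _∸_; _%_; NonZero)
open import Data.Nat.DivMod using (m%n<n)
open import Data.Fin using (Fin; toℕ; fromℕ<)
open import Data.Fin.Subset using (Subset; ∣_∣; _∈_)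
open import Data.Fin.Permutation using (Permutation′; _⟨$⟩ʳ_)
open import Data.Product using (Σ; _×_; proj₁)
open import Relation.Binary.PropositionalEquality using (_≡_)
open import Function.Definitions using (Injective)

Edge : ℕ → ℕ → Set
Edge n r = Σ (Subset n) (λ e → ∣ e ∣ ≡ r)

Colouring : ℕ → ℕ → ℕ → Set
Colouring n r k = Edge n r → Fin k

next : ∀ {n} → Fin n → Fin n
next {suc n} j = fromℕ< (m%n<n (suc (toℕ j)) (suc n))

record MonoHamBergeCycle {n r k : ℕ} (χ : Colouring n r k) : Set where
  field
    colour : Fin k
    core   : Permutation′ n
    edges  : Fin n → Edge n r
    distinct : Injective _≡_ _≡_ (λ j → proj₁ (edges j))
    contains-this : ∀ j → (core ⟨$⟩ʳ j) ∈ proj₁ (edges j)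
    contains-next : ∀ j → (core ⟨$⟩ʳ next j) ∈ proj₁ (edges j)
    mono : ∀ j → χ (edges j) ≡ colour

{-# OPTIONS --safe #-}
module Submission where

open import Defs
open import Data.Bool using (true; false)
import Data.Bool.Properties as Bool
open import Data.Nat using (ℕ; zero; suc; _≤_; _<_; _+_; _*_; _∸_; _%_; z≤n; s≤s)
open import Data.Nat.DivMod using (m<n⇒m%n≡m; n%n≡0; [m+n]%n≡m%n; %-distribˡ-+; m%n%n≡m%n; m%n<n)
open import Data.Nat.ListAction using (sum)
open import Data.Nat.Properties hiding (_≟_; suc-injective)
open import Data.Nat.Solver using (module +-*-Solver)
open import Data.Fin using (Fin; zero; suc; toℕ; fromℕ<; cast)
open import Data.Fin.Permutation using (Permutation′; permutation; _⟨$⟩ʳ_; _⟨$⟩ˡ_; inverseˡ; inverseʳ)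
open import Data.Fin.Properties using (_≟_; any?; ¬∀⟶∃¬; suc-injective; toℕ-cast; toℕ-injective; toℕ<n; toℕ-fromℕ<; cast-involutive)
open import Data.Fin.Subset using (Subset; ∣_∣; _∈_; _∉_; _⊆_; _∪_; ⊤; ⊥; ⁅_⁆; ∁; Nonempty; inside; outside)
open import Data.Fin.Subset.Properties using (_∈?_; p⊆q⇒∣p∣≤∣q∣; p⊂q⇒∣p∣<∣q∣; ∣⊤∣≡n; ∣⊥∣≡0; ∣⁅x⁆∣≡1; x∈p∪q⁺; x∈p∪q⁻; p⊆p∪q; x∈⁅x⁆; x∈⁅y⁆⇒x≡y; ∣∁p∣≡n∸∣p∣; x∈∁p⇒x∉p; nonempty?; Empty-unique; in⊆in; out⊆; ⊆⊤; ⊆-refl)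
open import Data.Vec using ([]; _∷_; here; there; tabulate)
import Data.Vec.Properties as Vec
open import Data.Vec.Properties using (lookup∘tabulate; []=⇒lookup; lookup⇒[]=)
open import Data.List using (List; []; _∷_; length; map; _++_; reverse; filter; lookup; allFin; cartesianProduct; concatMap)
open import Data.List.Extrema.Nat using (argmax; argmax-all; f[xs]≤f[argmax])
import Data.List.Membership.DecPropositional as DecMembership
open import Data.List.Membership.Propositional using (find; lose) renaming (_∈_ to _∈ˡ_)
open import Data.List.Membership.Propositional.Properties using (∈-∃++; ∈-++⁻; ∈-++⁺ˡ; ∈-++⁺ʳ; ∈-map⁺; ∈-map⁻; ∈-filter⁺; ∈-filter⁻; ∈-allFin; ∈-cartesianProduct⁺; ∈-concatMap⁺; ∈-lookup)
open import Data.List.Properties using (length-map; length-++; unfold-reverse; length-tabulate; filter-notAll)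
open import Data.List.Relation.Binary.Permutation.Propositional using (_↭_; ↭-refl; ↭-sym; ↭-trans; ↭⇒↭ₛ)
open import Data.List.Relation.Binary.Permutation.Propositional.Properties using (∈-resp-↭; ↭-length; ↭-reverse; ++⁺ˡ; ++-comm)
import Data.List.Relation.Binary.Permutation.Setoid.Properties as ↭ₛ
open import Data.List.Relation.Unary.All using (All; []; _∷_)
import Data.List.Relation.Unary.All as All
open import Data.List.Relation.Unary.All.Properties using (¬All⇒Any¬)
open import Data.List.Relation.Unary.AllPairs using (AllPairs; []; _∷_)
open import Data.List.Relation.Unary.Any using (here; there; index)
import Data.List.Relation.Unary.Any as Any
open import Data.List.Relation.Unary.Any.Properties using (lookup-index)
open import Data.List.Relation.Unary.Linked.Properties using (Linked⇒AllPairs)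
open import Data.List.Relation.Unary.Unique.Propositional using (Unique)
import Data.List.Relation.Unary.Unique.Propositional.Properties as Unique
import Data.List.Sort as Sort
open import Data.Product using (∃; ∃₂; Σ; _×_; _,_; proj₁; proj₂)
open import Data.Product.Properties using (≡-dec)
open import Data.Sum using (_⊎_; inj₁; inj₂; [_,_]′)
import Relation.Binary.Construct.Flip.EqAndOrd as Flip
import Relation.Binary.Construct.On as On
open import Relation.Binary.Definitions using (DecidableEquality)
open import Relation.Binary.PropositionalEquality hiding (J; [_])
open import Relation.Nullary using (¬_; Dec; yes; no; does; contradiction; ¬?; _×-dec_; _⊎-dec_)
open import Relation.Nullary.Decidable using (dec-true)

-- Put k = r − 2, and join x and y in the graph Gᵢ when at least r − 1 edges of colour i contain both.
-- If some Gᵢ has a Hamiltonian cycle, then, since an r-set contains at most r − 1 of the n > r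
-- consecutive pairs of the cycle, Hall's theorem picks distinct edges of colour i for these pairs.
--
-- Otherwise Pósa's theorem gives for every i some dᵢ < n/2 and a nonempty set Dᵢ of at least dᵢ
-- vertices of degree at most dᵢ in Gᵢ. Taking the colours in increasing order of dᵢ, one finds
-- non-adjacent pairs, one in each Gᵢ, which together span at most k + 1 = r − 1 vertices: at each
-- stage such pairs can be found through any vertex outside an exceptional set of at most dᵢ vertices.
-- Enlarge their union to a set W of size r − 1. Each of the n − r + 1 > k² edges W ∪ {z} contains
-- the pair chosen for its own colour, but at most r − 2 = k edges of colour i contain the i-th pair.

private variable
  n r k   : ℕ
  A X Y   : Set
  a b c d : A
  l m     : List A

-- Lists and subsets

unique-⊆⇒length≤ : {xs ys : List A} → Unique xs → (∀ {x} → x ∈ˡ xs → x ∈ˡ ys) → length xs ≤ length ys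
unique-⊆⇒length≤ [] _ = z≤n
unique-⊆⇒length≤ {xs = x ∷ xs} (x≢ ∷ u) sub with ∈-∃++ (sub (here refl))
... | ps , qs , refl = ≤-trans (s≤s (unique-⊆⇒length≤ u sub′)) (≤-reflexive (sym length-insert))
  where
  length-insert : length (ps ++ x ∷ qs) ≡ suc (length (ps ++ qs))
  length-insert = trans (length-++ ps) (trans (+-suc _ _) (cong suc (sym (length-++ ps))))
  sub′ : ∀ {y} → y ∈ˡ xs → y ∈ˡ ps ++ qs
  sub′ y∈xs with ∈-++⁻ ps (sub (there y∈xs))
  ... | inj₁ y∈ps         = ∈-++⁺ˡ y∈ps
  ... | inj₂ (here refl)  = contradiction refl (All.lookup x≢ y∈xs)
  ... | inj₂ (there y∈qs) = ∈-++⁺ʳ ps y∈qs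

elements : Subset n → List (Fin n)
elements []          = []
elements (true ∷ p)  = zero ∷ map suc (elements p)
elements (false ∷ p) = map suc (elements p)

length-elements : (p : Subset n) → length (elements p) ≡ ∣ p ∣
length-elements []          = refl
length-elements (true ∷ p)  = cong suc (trans (length-map suc (elements p)) (length-elements p))
length-elements (false ∷ p) = trans (length-map suc (elements p)) (length-elements p)

∈-elements⁺ : {p : Subset n} {x : Fin n} → x ∈ p → x ∈ˡ elements p
∈-elements⁺ here = here refl
∈-elements⁺ {p = true ∷ p}  (there x∈p) = there (∈-map⁺ suc (∈-elements⁺ x∈p))
∈-elements⁺ {p = false ∷ p} (there x∈p) = ∈-map⁺ suc (∈-elements⁺ x∈p)

∈-elements⁻ : (p : Subset n) {x : Fin n} → x ∈ˡ elements p → x ∈ p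
∈-elements⁻ (true ∷ p) (here refl) = here
∈-elements⁻ (true ∷ p) (there x∈) with ∈-map⁻ suc x∈
... | _ , y∈ , refl = there (∈-elements⁻ p y∈)
∈-elements⁻ (false ∷ p) x∈ with ∈-map⁻ suc x∈
... | _ , y∈ , refl = there (∈-elements⁻ p y∈)

elements-unique : (p : Subset n) → Unique (elements p)
elements-unique []          = []
elements-unique (true ∷ p)  = All.tabulate (λ x∈ 0≡x → zero∉ (subst (_∈ˡ _) (sym 0≡x) x∈)) ∷ Unique.map⁺ suc-injective (elements-unique p)
  where
  zero∉ : ¬ zero ∈ˡ map suc (elements p)
  zero∉ 0∈ with ∈-map⁻ suc 0∈
  ... | _ , _ , ()
elements-unique (false ∷ p) = Unique.map⁺ suc-injective (elements-unique p)

∣p∪q∣≤∣p∣+∣q∣ : (p q : Subset n) → ∣ p ∪ q ∣ ≤ ∣ p ∣ + ∣ q ∣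
∣p∪q∣≤∣p∣+∣q∣ []          []          = z≤n
∣p∪q∣≤∣p∣+∣q∣ (true ∷ p)  (true ∷ q)  = s≤s (≤-trans (∣p∪q∣≤∣p∣+∣q∣ p q) (+-monoʳ-≤ ∣ p ∣ (n≤1+n ∣ q ∣)))
∣p∪q∣≤∣p∣+∣q∣ (true ∷ p)  (false ∷ q) = s≤s (∣p∪q∣≤∣p∣+∣q∣ p q)
∣p∪q∣≤∣p∣+∣q∣ (false ∷ p) (true ∷ q)  = ≤-trans (s≤s (∣p∪q∣≤∣p∣+∣q∣ p q)) (≤-reflexive (sym (+-suc ∣ p ∣ ∣ q ∣)))
∣p∪q∣≤∣p∣+∣q∣ (false ∷ p) (false ∷ q) = ∣p∪q∣≤∣p∣+∣q∣ p q

∣p∣<n⇒∃∉ : (p : Subset n) → ∣ p ∣ < n → ∃ λ x → x ∉ p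
∣p∣<n⇒∃∉ {n} p ∣p∣<n = ¬∀⟶∃¬ n (_∈ p) (_∈? p) λ all∈ →
  <⇒≱ ∣p∣<n (≤-trans (≤-reflexive (sym (∣⊤∣≡n n))) (p⊆q⇒∣p∣≤∣q∣ {p = ⊤} (λ {x} _ → all∈ x)))

⊆∧∣≥∣⇒⊇ : {p q : Subset n} → p ⊆ q → ∣ q ∣ ≤ ∣ p ∣ → q ⊆ p
⊆∧∣≥∣⇒⊇ {p = p} p⊆q ∣q∣≤∣p∣ {x} x∈q with x ∈? p
... | yes x∈p = x∈p
... | no x∉p  = contradiction ∣q∣≤∣p∣ (<⇒≱ (p⊂q⇒∣p∣<∣q∣ (p⊆q , x , x∈q , x∉p)))

extend : (p : Subset n) (m : ℕ) → ∣ p ∣ ≤ m → m ≤ n → ∃ λ q → p ⊆ q × ∣ q ∣ ≡ m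
extend [] zero _ _ = [] , ⊆-refl , refl
extend (true ∷ p) (suc m) (s≤s ∣p∣≤m) (s≤s m≤n) with extend p m ∣p∣≤m m≤n
... | q , p⊆q , ∣q∣≡m = inside ∷ q , in⊆in p⊆q , cong suc ∣q∣≡m
extend {suc n} (false ∷ p) m ∣p∣≤m m≤1+n with m ≤? n
... | yes m≤n with extend p m ∣p∣≤m m≤n
...   | q , p⊆q , ∣q∣≡m = outside ∷ q , out⊆ p⊆q , ∣q∣≡m
extend {suc n} (false ∷ p) m ∣p∣≤m m≤1+n | no m≰n =
  ⊤ , ⊆⊤ , trans (∣⊤∣≡n (suc n)) (≤-antisym (≰⇒> m≰n) m≤1+n)

module _ {P : Fin n → Set} (P? : ∀ x → Dec (P x)) where

  comprehension : Subset n
  comprehension = tabulate λ x → does (P? x)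

  ∈-comprehension⁺ : ∀ {x} → P x → x ∈ comprehension
  ∈-comprehension⁺ {x} Px = lookup⇒[]= x _ (trans (lookup∘tabulate _ x) (dec-true (P? x) Px))

  ∈-comprehension⁻ : ∀ {x} → x ∈ comprehension → P x
  ∈-comprehension⁻ {x} x∈ with P? x | trans (sym (lookup∘tabulate (λ x → does (P? x)) x)) ([]=⇒lookup x∈)
  ... | yes Px | _ = Px

-- Injectivity is asked on the list only: `fewExtensions` applies this to adding `z` to `W`, which
-- is injective off `W`.
unique-map : {A B : Set} {f : A → B} {xs : List A} → (∀ {x y} → x ∈ˡ xs → y ∈ˡ xs → f x ≡ f y → x ≡ y) →
  Unique xs → Unique (map f xs)
unique-map inj [] = []
unique-map {f = f} {xs = x ∷ xs} inj (x≢ ∷ u) = All.tabulate fresh ∷ unique-map (λ x∈ y∈ → inj (there x∈) (there y∈)) u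
  where
  fresh : ∀ {b} → b ∈ˡ map f xs → f x ≢ b
  fresh b∈ fx≡b with ∈-map⁻ f b∈
  ... | y , y∈ , refl = All.lookup x≢ y∈ (inj (here refl) (there y∈) fx≡b)

unique-lookup-injective : {A : Set} {xs : List A} → Unique xs → ∀ i j → lookup xs i ≡ lookup xs j → i ≡ j
unique-lookup-injective (_ ∷ _)  zero    zero    _  = refl
unique-lookup-injective (x≢ ∷ _) zero    (suc j) eq = contradiction eq (All.lookup x≢ (∈-lookup j))
unique-lookup-injective (x≢ ∷ _) (suc i) zero    eq = contradiction (sym eq) (All.lookup x≢ (∈-lookup i))
unique-lookup-injective (_ ∷ u)  (suc i) (suc j) eq = cong suc (unique-lookup-injective u i j eq)

length-concatMap-≤ : {A B : Set} (f : A → List B) (c : ℕ) (xs : List A) → (∀ x → length (f x) ≤ c) →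
  length (concatMap f xs) ≤ length xs * c
length-concatMap-≤ f c []       _  = z≤n
length-concatMap-≤ f c (x ∷ xs) ≤c = ≤-trans (≤-reflexive (length-++ (f x))) (+-mono-≤ (≤c x) (length-concatMap-≤ f c xs ≤c))

subsets : ∀ n → List (Subset n)
subsets zero    = [] ∷ []
subsets (suc n) = map (outside ∷_) (subsets n) ++ map (inside ∷_) (subsets n)

∈-subsets : (p : Subset n) → p ∈ˡ subsets n
∈-subsets []          = here refl
∈-subsets (false ∷ p) = ∈-++⁺ˡ (∈-map⁺ (outside ∷_) (∈-subsets p))
∈-subsets {suc n} (true ∷ p) = ∈-++⁺ʳ (map (outside ∷_) (subsets n)) (∈-map⁺ (inside ∷_) (∈-subsets p))

subsets-unique : ∀ n → Unique (subsets n)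
subsets-unique zero    = [] ∷ []
subsets-unique (suc n) = Unique.++⁺ (Unique.map⁺ Vec.∷-injectiveʳ (subsets-unique n)) (Unique.map⁺ Vec.∷-injectiveʳ (subsets-unique n))
  λ (p∈ , q∈) → disjoint (∈-map⁻ (outside ∷_) p∈) (∈-map⁻ (inside ∷_) q∈)
  where
  disjoint : ∀ {p : Subset (suc n)} → ∃ (λ q → q ∈ˡ subsets n × p ≡ outside ∷ q) → ¬ ∃ (λ q → q ∈ˡ subsets n × p ≡ inside ∷ q)
  disjoint (_ , _ , refl) (_ , _ , ())

_≟ˢ_ : (p q : Subset n) → Dec (p ≡ q)
_≟ˢ_ = Vec.≡-dec Bool._≟_

∣p∪⁅x⁆∣≡1+∣p∣ : (p : Subset n) {x : Fin n} → x ∉ p → ∣ p ∪ ⁅ x ⁆ ∣ ≡ suc ∣ p ∣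
∣p∪⁅x⁆∣≡1+∣p∣ p {x} x∉p = ≤-antisym
  (≤-trans (∣p∪q∣≤∣p∣+∣q∣ p ⁅ x ⁆) (≤-reflexive (trans (cong (∣ p ∣ +_) (∣⁅x⁆∣≡1 x)) (+-comm ∣ p ∣ 1))))
  (p⊂q⇒∣p∣<∣q∣ (p⊆p∪q ⁅ x ⁆ , x , x∈p∪q⁺ (inj₂ (x∈⁅x⁆ x)) , x∉p))

-- Hamiltonian cycles in graphs

indicator : {P : Set} → Dec P → ℕ
indicator (yes _) = 1
indicator (no _)  = 0

-- A sum of indicators, so that it unfolds along a path and double sums can be interchanged in
-- Hall's argument.
count : {P : A → Set} → (∀ x → Dec (P x)) → List A → ℕ
count P? xs = sum (map (λ x → indicator (P? x)) xs)

count≡length-filter : {P : A → Set} (P? : ∀ x → Dec (P x)) (xs : List A) → count P? xs ≡ length (filter P? xs)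
count≡length-filter P? []       = refl
count≡length-filter P? (x ∷ xs) with P? x
... | yes _ = cong suc (count≡length-filter P? xs)
... | no _  = count≡length-filter P? xs

unique-resp-↭ : l ↭ m → Unique l → Unique m
unique-resp-↭ l↭m = ↭ₛ.Unique-resp-↭ (setoid _) (↭⇒↭ₛ l↭m)

unique-++⇒disjoint : ∀ l → Unique (l ++ m) → a ∈ˡ l → ¬ a ∈ˡ m
unique-++⇒disjoint (_ ∷ l) (x≢ ∷ _) (here refl) a∈m = All.lookup x≢ (∈-++⁺ʳ l a∈m) refl
unique-++⇒disjoint (_ ∷ l) (_ ∷ u)  (there a∈l) a∈m = unique-++⇒disjoint l u a∈l a∈m

unique-++⁻ˡ : ∀ l → Unique (l ++ m) → Unique l
unique-++⁻ˡ []      _        = []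
unique-++⁻ˡ (_ ∷ l) (x≢ ∷ u) = All.tabulate (λ y∈ → All.lookup x≢ (∈-++⁺ˡ y∈)) ∷ unique-++⁻ˡ l u

unique-++⁻ʳ : ∀ l → Unique (l ++ m) → Unique m
unique-++⁻ʳ []      u       = u
unique-++⁻ʳ (_ ∷ l) (_ ∷ u) = unique-++⁻ʳ l u

-- The list index records every vertex, both ends included, so cutting, joining and reversing paths
-- are list operations.
data Path {A : Set} (R : A → A → Set) : A → List A → A → Set where
  [_] : ∀ a → Path R a (a ∷ []) a
  _∷_ : ∀ {a b c l} → R a b → Path R b l c → Path R a (a ∷ l) c

module _ {R : A → A → Set} where

  start∈ : Path R a l b → a ∈ˡ l
  start∈ [ _ ]   = here refl
  start∈ (_ ∷ _) = here refl

  end∈ : Path R a l b → b ∈ˡ l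
  end∈ [ _ ]   = here refl
  end∈ (_ ∷ p) = there (end∈ p)

  join : Path R a l b → R b c → Path R c m d → Path R a (l ++ m) d
  join [ _ ]   bc q = bc ∷ q
  join (r ∷ p) bc q = r ∷ join p bc q

  reversePath : (∀ {x y} → R x y → R y x) → Path R a l b → Path R b (reverse l) a
  reversePath R-sym [ a ] = [ a ]
  reversePath R-sym (_∷_ {a = a} {l = l} r p) =
    subst (λ xs → Path R _ xs a) (sym (unfold-reverse a l)) (join (reversePath R-sym p) (R-sym r) [ a ])

  loop-trivial : Unique l → Path R a l a → l ≡ a ∷ []
  loop-trivial _        [ _ ]   = refl
  loop-trivial (x≢ ∷ _) (_ ∷ p) = contradiction refl (All.lookup x≢ (end∈ p))

  completePath : (∀ {x y} → x ≢ y → R x y) → Unique (a ∷ l) → ∃ λ b → Path R a (a ∷ l) b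
  completePath {a = a} {l = []} _ _ = a , [ a ]
  completePath {l = _ ∷ _} complete ((a≢ ∷ _) ∷ u) with completePath complete u
  ... | b , p = b , complete a≢ ∷ p

avoidPath : {R R′ : A → A → Set} → (∀ {x y} → x ∈ˡ l → y ∈ˡ l → R′ x y → R x y) → Path R′ a l b → Path R a l b
avoidPath f [ a ]   = [ a ]
avoidPath f (r ∷ p) = f (here refl) (there (start∈ p)) r ∷ avoidPath (λ x∈ y∈ → f (there x∈) (there y∈)) p

record Graph (n : ℕ) : Set where
  field
    N        : Fin n → Subset n
    N-sym    : ∀ {x y} → y ∈ N x → x ∈ N y
    N-irrefl : ∀ {x} → x ∉ N x

  Adj : Fin n → Fin n → Set
  Adj x y = y ∈ N x

  deg : Fin n → ℕ
  deg x = ∣ N x ∣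

open Graph

record HamCycle (G : Graph n) : Set where
  field
    {start end} : Fin n
    {vertices}  : List (Fin n)
    path        : Path (Adj G) start vertices end
    closed      : Adj G end start
    spanning    : vertices ↭ allFin n

-- Failure of Pósa's degree condition. `nonempty` settles `bound` 0, where an isolated vertex is
-- required.
record Obstruction (G : Graph n) : Set where
  field
    bound     : ℕ
    2bound<n  : bound + bound < n
    D         : Subset n
    nonempty  : Nonempty D
    bound≤∣D∣ : bound ≤ ∣ D ∣
    deg≤bound : ∀ {x} → x ∈ D → deg G x ≤ bound

record Crossing (R : Fin n → Fin n → Set) (P Q : Subset n) (a : Fin n) (l : List (Fin n)) (b : Fin n) : Set where
  constructor crossing
  field
    {front back} : List (Fin n)
    {x y}        : Fin n
    split        : l ≡ front ++ back
    frontPath    : Path R a front x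
    backPath     : Path R y back b
    x∈Q          : x ∈ Q
    y∈P          : y ∈ P

∣p∣≤count : (p : Subset n) {l : List (Fin n)} → (∀ {x} → x ∈ p → x ∈ˡ l) → ∣ p ∣ ≤ count (_∈? p) l
∣p∣≤count p {l} p⊆l = begin
  ∣ p ∣                        ≡⟨ length-elements p ⟨
  length (elements p)          ≤⟨ unique-⊆⇒length≤ (elements-unique p) (λ x∈ → ∈-filter⁺ (_∈? p) (p⊆l (∈-elements⁻ p x∈)) (∈-elements⁻ p x∈)) ⟩
  length (filter (_∈? p) l)    ≡⟨ count≡length-filter (_∈? p) l ⟨
  count (_∈? p) l              ∎
  where open ≤-Reasoning

indicator-no : {P : Set} (P? : Dec P) → ¬ P → indicator P? ≡ 0
indicator-no (yes p) ¬p = contradiction p ¬p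
indicator-no (no _)  _  = refl

-- Without a crossing, each consecutive pair contributes at most one: its first vertex to `Q` or its
-- second to `P`. This leaves out only `a` for `P` and `b` for `Q`, hence the two indicators.
crossing-or-few : {R : Fin n → Fin n → Set} (P Q : Subset n) {a b : Fin n} {l : List (Fin n)} → Path R a l b →
  Crossing R P Q a l b ⊎
  suc (count (_∈? P) l + count (_∈? Q) l) ≤ length l + (indicator (a ∈? P) + indicator (b ∈? Q))
crossing-or-few P Q [ a ] = inj₂ (s≤s (≤-reflexive (cong₂ _+_ (+-identityʳ (indicator (a ∈? P))) (+-identityʳ (indicator (a ∈? Q))))))
crossing-or-few P Q (_∷_ {a = a} {b = b} {c = c} {l = l} r p) with crossing-or-few P Q p
... | inj₁ (crossing refl f g x∈Q y∈P) = inj₁ (crossing refl (r ∷ f) g x∈Q y∈P)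
... | inj₂ few with b ∈? P | a ∈? Q | add (indicator (a ∈? Q)) (indicator (b ∈? P))
  where
  cP = count (_∈? P) l
  cQ = count (_∈? Q) l
  iP = indicator (a ∈? P)
  iQ = indicator (c ∈? Q)
  -- `e` and `j` tell whether the first pair counts for `Q` and for `P`; both together would be a
  -- crossing, so `e + j` is at most 1.
  add : ∀ e j → e + j ≤ 1 → suc (cP + cQ) ≤ length l + (j + iQ) →
    suc ((iP + cP) + (e + cQ)) ≤ suc (length l) + (iP + iQ)
  add e j e+j≤1 h = begin
    suc ((iP + cP) + (e + cQ))           ≡⟨ solve 4 (λ i x e y → con 1 :+ ((i :+ x) :+ (e :+ y)) := (i :+ e) :+ (con 1 :+ (x :+ y))) refl iP cP e cQ ⟩
    (iP + e) + suc (cP + cQ)             ≤⟨ +-monoʳ-≤ (iP + e) h ⟩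
    (iP + e) + (length l + (j + iQ))     ≡⟨ solve 5 (λ i e z j w → (i :+ e) :+ (z :+ (j :+ w)) := (e :+ j) :+ (z :+ (i :+ w))) refl iP e (length l) j iQ ⟩
    (e + j) + (length l + (iP + iQ))     ≤⟨ +-monoˡ-≤ _ e+j≤1 ⟩
    suc (length l) + (iP + iQ)           ∎
    where open ≤-Reasoning
          open +-*-Solver
...   | yes b∈P | yes a∈Q | _     = inj₁ (crossing refl [ a ] p a∈Q b∈P)
...   | yes _   | no _    | bound = inj₂ (bound ≤-refl few)
...   | no _    | yes _   | bound = inj₂ (bound ≤-refl few)
...   | no _    | no _    | bound = inj₂ (bound z≤n few)

length-allFin : ∀ n → length (allFin n) ≡ n
length-allFin n = length-tabulate {n = n} (λ x → x)

-- Ore's rotation: some edge xy of the path has x adjacent to b and y adjacent to a.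
path⇒HamCycle : (G : Graph n) {a b : Fin n} {l : List (Fin n)} → Path (Adj G) a l b → l ↭ allFin n →
  n ≤ deg G a + deg G b → HamCycle G
path⇒HamCycle {n} G {a} {b} {l} p l↭ n≤ with crossing-or-few (N G a) (N G b) p
... | inj₁ (crossing {front = f} {back = g} refl pf pg x∈ y∈) = record
  { path     = join pf (N-sym G x∈) (reversePath (N-sym G) pg)
  ; closed   = N-sym G y∈
  ; spanning = ↭-trans (++⁺ˡ f (↭-reverse g)) l↭
  }
... | inj₂ few = contradiction (≤-trans (s≤s (≤-trans n≤ (+-mono-≤ (full (N G a)) (full (N G b))))) few) (<⇒≱ (s≤s (≤-reflexive length≡n)))
  where
  full : ∀ q → ∣ q ∣ ≤ count (_∈? q) l
  full q = ∣p∣≤count q (λ {x} _ → ∈-resp-↭ (↭-sym l↭) (∈-allFin x))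
  -- No vertex is its own neighbour, so both end indicators vanish and `few` would push the degree
  -- sum below `n`.
  length≡n : length l + (indicator (a ∈? N G a) + indicator (b ∈? N G b)) ≡ n
  length≡n = begin
    length l + (indicator (a ∈? N G a) + indicator (b ∈? N G b)) ≡⟨ cong (length l +_) (cong₂ _+_ (indicator-no (a ∈? N G a) (N-irrefl G)) (indicator-no (b ∈? N G b) (N-irrefl G))) ⟩
    length l + 0                                                 ≡⟨ +-identityʳ _ ⟩
    length l                                                     ≡⟨ ↭-length l↭ ⟩
    length (allFin n)                                            ≡⟨ length-allFin n ⟩
    n                                                            ∎
    where open ≡-Reasoning

-- The Bondy-Chvátal closure: adding one edge

module AddEdge (G : Graph n) (u v : Fin n) (u≢v : u ≢ v) where

  New : Fin n → Fin n → Set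
  New x y = (x ≡ u × y ≡ v) ⊎ (x ≡ v × y ≡ u)

  Adj⁺ : Fin n → Fin n → Set
  Adj⁺ x y = Adj G x y ⊎ New x y

  Adj⁺? : ∀ x y → Dec (Adj⁺ x y)
  Adj⁺? x y = (y ∈? N G x) ⊎-dec (((x ≟ u) ×-dec (y ≟ v)) ⊎-dec ((x ≟ v) ×-dec (y ≟ u)))

  Adj⁺-sym : ∀ {x y} → Adj⁺ x y → Adj⁺ y x
  Adj⁺-sym (inj₁ y∈)                   = inj₁ (N-sym G y∈)
  Adj⁺-sym (inj₂ (inj₁ (refl , refl))) = inj₂ (inj₂ (refl , refl))
  Adj⁺-sym (inj₂ (inj₂ (refl , refl))) = inj₂ (inj₁ (refl , refl))

  Adj⁺-irrefl : ∀ {x} → ¬ Adj⁺ x x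
  Adj⁺-irrefl (inj₁ x∈)                   = N-irrefl G x∈
  Adj⁺-irrefl (inj₂ (inj₁ (refl , refl))) = u≢v refl
  Adj⁺-irrefl (inj₂ (inj₂ (refl , refl))) = u≢v refl

  addEdge : Graph n
  addEdge = record
    { N        = λ x → comprehension (Adj⁺? x)
    ; N-sym    = λ {x} {y} y∈ → ∈-comprehension⁺ (Adj⁺? y) (Adj⁺-sym (∈-comprehension⁻ (Adj⁺? x) y∈))
    ; N-irrefl = λ {x} x∈ → Adj⁺-irrefl (∈-comprehension⁻ (Adj⁺? x) x∈)
    }

  addEdge⁺ : ∀ {x y} → Adj⁺ x y → Adj addEdge x y
  addEdge⁺ {x} = ∈-comprehension⁺ (Adj⁺? x)

  addEdge⁻ : ∀ {x y} → Adj addEdge x y → Adj⁺ x y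
  addEdge⁻ {x} = ∈-comprehension⁻ (Adj⁺? x)

  deg≤deg-addEdge : ∀ x → deg G x ≤ deg addEdge x
  deg≤deg-addEdge x = p⊆q⇒∣p∣≤∣q∣ (λ y∈ → addEdge⁺ (inj₁ y∈))

  record Broken (a : Fin n) (l : List (Fin n)) (b : Fin n) : Set where
    constructor broken
    field
      {front back} : List (Fin n)
      {s t}        : Fin n
      split        : l ≡ front ++ back
      frontPath    : Path (Adj G) a front s
      backPath     : Path (Adj G) t back b
      new          : New s t

  -- Using the new edge in either direction means visiting both of its ends, `s` among them.
  pathWithout : ∀ {a b s t l} → New s t → ¬ s ∈ˡ l → Path (Adj addEdge) a l b → Path (Adj G) a l b
  pathWithout {l = l} st s∉ = avoidPath λ x∈ y∈ xy → [ (λ r → r) , (λ new → contradiction (new-end st new x∈ y∈) s∉) ]′ (addEdge⁻ xy)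
    where
    new-end : ∀ {s t x y} → New s t → New x y → x ∈ˡ l → y ∈ˡ l → s ∈ˡ l
    new-end (inj₁ (refl , refl)) (inj₁ (refl , refl)) x∈ y∈ = x∈
    new-end (inj₁ (refl , refl)) (inj₂ (refl , refl)) x∈ y∈ = y∈
    new-end (inj₂ (refl , refl)) (inj₁ (refl , refl)) x∈ y∈ = y∈
    new-end (inj₂ (refl , refl)) (inj₂ (refl , refl)) x∈ y∈ = x∈

  -- At the first use of the new edge the path leaves an end of it, which never recurs because
  -- vertices are distinct; so the rest of the path is old.
  breakPath : ∀ {a b l} → Unique l → Path (Adj addEdge) a l b → Path (Adj G) a l b ⊎ Broken a l b
  breakPath _        [ a ]   = inj₁ [ a ]
  breakPath (x≢ ∷ w) (r ∷ p) with addEdge⁻ r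
  ... | inj₂ new = inj₂ (broken refl [ _ ] (pathWithout new (λ s∈ → All.lookup x≢ s∈ refl) p) new)
  ... | inj₁ old with breakPath w p
  ...   | inj₁ q                     = inj₁ (old ∷ q)
  ...   | inj₂ (broken refl f g new) = inj₂ (broken refl (old ∷ f) g new)

  -- If the cycle uses the new edge, dropping that edge leaves a Hamiltonian path of `G` between `u`
  -- and `v`, whose degree sum lets `path⇒HamCycle` close it again.
  HamCycle-addEdge⁻ : 3 ≤ n → n ≤ deg G u + deg G v → HamCycle addEdge → HamCycle G
  HamCycle-addEdge⁻ 3≤n n≤ C = go (breakPath unique path) (addEdge⁻ closed)
    where
    open HamCycle C
    unique : Unique vertices
    unique = unique-resp-↭ (↭-sym spanning) (Unique.allFin⁺ n)
    ends : ∀ {s t} → New s t → n ≤ deg G s + deg G t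
    ends (inj₁ (refl , refl)) = n≤
    ends (inj₂ (refl , refl)) = subst (n ≤_) (+-comm (deg G u) (deg G v)) n≤
    swapNew : ∀ {s t} → New s t → New t s
    swapNew (inj₁ (refl , refl)) = inj₂ (refl , refl)
    swapNew (inj₂ (refl , refl)) = inj₁ (refl , refl)
    new-unique : ∀ {s t x y} → New s t → New x y → (s ≡ x) ⊎ (t ≡ x × s ≡ y)
    new-unique (inj₁ (refl , refl)) (inj₁ (refl , refl)) = inj₁ refl
    new-unique (inj₁ (refl , refl)) (inj₂ (refl , refl)) = inj₂ (refl , refl)
    new-unique (inj₂ (refl , refl)) (inj₁ (refl , refl)) = inj₂ (refl , refl)
    new-unique (inj₂ (refl , refl)) (inj₂ (refl , refl)) = inj₁ refl
    go : Path (Adj G) start vertices end ⊎ Broken start vertices end → Adj⁺ end start → HamCycle G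
    go (inj₁ p) (inj₁ old) = record { path = p ; closed = old ; spanning = spanning }
    go (inj₁ p) (inj₂ new) = path⇒HamCycle G p spanning (ends (swapNew new))
    -- The new edge lies inside the path: running through the back half, the closing edge and the
    -- front half gives a path from `t` to `s`.
    go (inj₂ (broken {front = f} {back = g} split pf pg new)) (inj₁ old) =
      path⇒HamCycle G (join pg old pf) (↭-trans (++-comm g f) (subst (_↭ allFin n) split spanning)) (ends (swapNew new))
    -- The new edge would be used twice. In the same direction, `end` lies in both halves; in
    -- opposite directions, each half is a single vertex and `n` is 2.
    go (inj₂ (broken {front = f} {back = g} split pf pg new)) (inj₂ new′) with new-unique new new′
    ... | inj₁ refl = contradiction (end∈ pg) (unique-++⇒disjoint f (subst Unique split unique) (end∈ pf))
    ... | inj₂ (refl , refl) = contradiction 3≤n (<⇒≱ (≤-reflexive (cong suc (sym 2≡n))))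
      where
      open ≡-Reasoning
      fg-unique : Unique (f ++ g)
      fg-unique = subst Unique split unique
      2≡n : 2 ≡ n
      2≡n = sym (begin
        n                 ≡⟨ length-allFin n ⟨
        length (allFin n) ≡⟨ ↭-length spanning ⟨
        length vertices   ≡⟨ cong length split ⟩
        length (f ++ g)   ≡⟨ cong₂ (λ x y → length (x ++ y)) (loop-trivial (unique-++⁻ˡ f fg-unique) pf) (loop-trivial (unique-++⁻ʳ f fg-unique) pg) ⟩
        2                 ∎)

-- Pósa's degree condition

Obstruction-mono : {G G′ : Graph n} → (∀ x → deg G x ≤ deg G′ x) → Obstruction G′ → Obstruction G
Obstruction-mono deg≤ O = record
  { bound = bound ; 2bound<n = 2bound<n ; D = D ; nonempty = nonempty ; bound≤∣D∣ = bound≤∣D∣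
  ; deg≤bound = λ {x} x∈D → ≤-trans (deg≤ x) (deg≤bound x∈D) }
  where open Obstruction O

maximiser : {P : Fin n → Set} (P? : ∀ x → Dec (P x)) (f : Fin n → ℕ) → ∃ P → ∃ λ x → P x × (∀ y → P y → f y ≤ f x)
maximiser {n} {P} P? f (x₀ , Px₀) =
  argmax f x₀ xs ,
  argmax-all f {P = P} Px₀ (All.tabulate (λ x∈ → proj₂ (∈-filter⁻ P? {xs = allFin n} x∈))) ,
  λ y Py → All.lookup (f[xs]≤f[argmax] {f = f} x₀ xs) (∈-filter⁺ P? (∈-allFin y) Py)
  where xs = filter P? (allFin n)

complete⇒HamCycle : (G : Graph n) → 3 ≤ n → (∀ {x y} → x ≢ y → Adj G x y) → HamCycle G
complete⇒HamCycle {suc (suc (suc n))} G (s≤s (s≤s (s≤s _))) complete with completePath {R = Adj G} complete (Unique.allFin⁺ (3 + n))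
... | b , p with b ≟ zero
...   | no b≢0   = record { path = p ; closed = complete b≢0 ; spanning = ↭-refl }
...   | yes refl = contradiction (loop-trivial (Unique.allFin⁺ (3 + n)) p) λ ()

module _ (G : Graph n) where

  NonAdj : Fin n → Fin n → Set
  NonAdj x y = x ≢ y × y ∉ N G x

  NonAdj? : ∀ x y → Dec (NonAdj x y)
  NonAdj? x y = ¬? (x ≟ y) ×-dec ¬? (y ∈? N G x)

  -- v has maximum degree among the vertices missing some neighbour, u among those not adjacent to v.
  closed⇒Obstruction : (∀ x y → NonAdj x y → deg G x + deg G y < n) → ∃₂ NonAdj → Obstruction G
  closed⇒Obstruction small (v₀ , u₀ , nonAdj₀)
    with maximiser (λ x → any? (NonAdj? x)) (deg G) (v₀ , u₀ , nonAdj₀)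
  ... | v , (u₁ , vu₁) , v-max with maximiser (NonAdj? v) (deg G) (u₁ , vu₁)
  ...   | u , vu@(v≢u , u∉Nv) , u-max = record
    { bound     = deg G u
    ; 2bound<n  = ≤-trans (s≤s (+-monoˡ-≤ (deg G u) du≤dv)) (small v u vu)
    ; D         = D
    ; nonempty  = u , ∈-comprehension⁺ (NonAdj? v) vu
    -- `D` consists of all vertices except `v` and its neighbours, so it has at least
    -- `n - 1 - deg v` elements, and this is at least `deg u` by `small`.
    ; bound≤∣D∣ = +-cancelʳ-≤ (suc (deg G v)) _ _ (begin
        deg G u + suc (deg G v)        ≡⟨ trans (+-suc _ _) (cong suc (+-comm (deg G u) (deg G v))) ⟩
        suc (deg G v + deg G u)        ≤⟨ small v u vu ⟩
        n                              ≡⟨ ∣⊤∣≡n n ⟨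
        ∣ ⊤ {n} ∣                      ≤⟨ p⊆q⇒∣p∣≤∣q∣ {p = ⊤} (λ {x} _ → cover x) ⟩
        ∣ D ∪ (⁅ v ⁆ ∪ N G v) ∣        ≤⟨ ∣p∪q∣≤∣p∣+∣q∣ D _ ⟩
        ∣ D ∣ + ∣ ⁅ v ⁆ ∪ N G v ∣      ≤⟨ +-monoʳ-≤ ∣ D ∣ (∣p∪q∣≤∣p∣+∣q∣ ⁅ v ⁆ (N G v)) ⟩
        ∣ D ∣ + (∣ ⁅ v ⁆ ∣ + deg G v)  ≡⟨ cong (λ k → ∣ D ∣ + (k + deg G v)) (∣⁅x⁆∣≡1 v) ⟩
        ∣ D ∣ + suc (deg G v)          ∎)
    ; deg≤bound = λ {x} x∈D → u-max x (∈-comprehension⁻ (NonAdj? v) x∈D)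
    }
    where
    open ≤-Reasoning
    D = comprehension (NonAdj? v)
    du≤dv : deg G u ≤ deg G v
    du≤dv = v-max u (v , (λ u≡v → v≢u (sym u≡v)) , λ v∈Nu → u∉Nv (N-sym G v∈Nu))
    cover : ∀ x → x ∈ D ∪ (⁅ v ⁆ ∪ N G v)
    cover x with v ≟ x | x ∈? N G v
    ... | yes refl | _      = x∈p∪q⁺ (inj₂ (x∈p∪q⁺ (inj₁ (x∈⁅x⁆ v))))
    ... | no _     | yes x∈ = x∈p∪q⁺ (inj₂ (x∈p∪q⁺ (inj₂ x∈)))
    ... | no v≢x   | no x∉  = x∈p∪q⁺ (inj₁ (∈-comprehension⁺ (NonAdj? v) (v≢x , x∉)))

private
  -- Edges are added between non-adjacent vertices of degree sum at least `n` until none qualify.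
  -- Both outcomes carry back: the cycle by `HamCycle-addEdge⁻`, the obstruction because degrees
  -- only grow. The list `pairs` of candidates for non-adjacency loses a member each time, which
  -- bounds the recursion.
  posa-fuel : 3 ≤ n → ∀ k (G : Graph n) (pairs : List (Fin n × Fin n)) → length pairs ≤ k →
    (∀ {x y} → NonAdj G x y → (x , y) ∈ˡ pairs) → HamCycle G ⊎ Obstruction G
  posa-fuel {n} 3≤n k G pairs len≤k all∈
    with any? (λ u → any? (λ v → NonAdj? G u v ×-dec (n ≤? deg G u + deg G v)))
  ... | no closed with any? (λ u → any? (NonAdj? G u))
  ...   | yes (u , v , uv) = inj₂ (closed⇒Obstruction G (λ x y xy → ≰⇒> λ n≤ → closed (x , y , xy , n≤)) (u , v , uv))
  ...   | no complete      = inj₁ (complete⇒HamCycle G 3≤n adjacent)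
    where
    adjacent : ∀ {x y} → x ≢ y → Adj G x y
    adjacent {x} {y} x≢y with y ∈? N G x
    ... | yes y∈ = y∈
    ... | no y∉  = contradiction (x , y , x≢y , y∉) complete
  posa-fuel 3≤n zero G [] len≤k all∈ | yes (u , v , uv , n≤) with () ← all∈ uv
  posa-fuel {n} 3≤n (suc k) G pairs len≤k all∈ | yes (u , v , uv , n≤)
    with posa-fuel 3≤n k G⁺ (filter ≢uv? pairs) (≤-pred (≤-trans (filter-notAll ≢uv? pairs (lose (all∈ uv) (λ ≢uv → ≢uv refl))) len≤k)) all∈⁺
    where
    open AddEdge G u v (proj₁ uv)
    G⁺ = addEdge
    ≢uv? = λ p → ¬? (≡-dec _≟_ _≟_ p (u , v))
    all∈⁺ : ∀ {x y} → NonAdj G⁺ x y → (x , y) ∈ˡ filter ≢uv? pairs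
    all∈⁺ (x≢y , y∉) = ∈-filter⁺ ≢uv? (all∈ (x≢y , λ y∈ → y∉ (addEdge⁺ (inj₁ y∈)))) λ { refl → y∉ (addEdge⁺ (inj₂ (inj₁ (refl , refl)))) }
  ... | inj₁ C = inj₁ (AddEdge.HamCycle-addEdge⁻ G u v (proj₁ uv) 3≤n n≤ C)
  ... | inj₂ O = inj₂ (Obstruction-mono (AddEdge.deg≤deg-addEdge G u v (proj₁ uv)) O)

-- Pósa's theorem, by the Bondy–Chvátal closure.
HamCycle-or-Obstruction : 3 ≤ n → (G : Graph n) → HamCycle G ⊎ Obstruction G
HamCycle-or-Obstruction {n} 3≤n G = posa-fuel 3≤n _ G (cartesianProduct (allFin n) (allFin n)) ≤-refl
  λ {x} {y} _ → ∈-cartesianProduct⁺ (∈-allFin x) (∈-allFin y)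

-- Systems of distinct representatives

sum-map-lower : (f : X → ℕ) (t : ℕ) (xs : List X) → (∀ {x} → x ∈ˡ xs → t ≤ f x) → length xs * t ≤ sum (map f xs)
sum-map-lower f t []       h = z≤n
sum-map-lower f t (x ∷ xs) h = +-mono-≤ (h (here refl)) (sum-map-lower f t xs (λ x∈ → h (there x∈)))

sum-map-upper : (f : X → ℕ) (t : ℕ) (xs : List X) → (∀ x → f x ≤ t) → sum (map f xs) ≤ length xs * t
sum-map-upper f t []       h = z≤n
sum-map-upper f t (x ∷ xs) h = +-mono-≤ (h x) (sum-map-upper f t xs h)

sum-map-0 : (xs : List X) → sum (map (λ _ → 0) xs) ≡ 0
sum-map-0 []       = refl
sum-map-0 (_ ∷ xs) = sum-map-0 xs

sum-map-+ : (f g : X → ℕ) (xs : List X) → sum (map (λ x → f x + g x) xs) ≡ sum (map f xs) + sum (map g xs)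
sum-map-+ f g []       = refl
sum-map-+ f g (x ∷ xs) = trans (cong (f x + g x +_) (sum-map-+ f g xs))
  (solve 4 (λ a b c d → a :+ b :+ (c :+ d) := a :+ c :+ (b :+ d)) refl (f x) (g x) (sum (map f xs)) (sum (map g xs)))
  where open +-*-Solver

sum-swap : (f : X → Y → ℕ) (xs : List X) (ys : List Y) →
  sum (map (λ x → sum (map (f x) ys)) xs) ≡ sum (map (λ y → sum (map (λ x → f x y) xs)) ys)
sum-swap f []       ys = sym (sum-map-0 ys)
sum-swap f (x ∷ xs) ys = trans (cong (sum (map (f x) ys) +_) (sum-swap f xs ys))
  (sym (sum-map-+ (f x) (λ y → sum (map (λ x → f x y) xs)) ys))

module Hall (_≟ˣ_ : DecidableEquality X) (_≟ʸ_ : DecidableEquality Y)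
  (L : X → List Y) (L-unique : ∀ x → Unique (L x)) (t : ℕ) (1≤t : 1 ≤ t) (t≤∣L∣ : ∀ x → t ≤ length (L x)) where

  open DecMembership _≟ˣ_ using () renaming (_∈?_ to _∈ˣ?_)
  open DecMembership _≟ʸ_ using () renaming (_∈?_ to _∈ʸ?_)

  -- A partial matching with domain `T`: `f` is total but constrained on `T` only, so the domain can
  -- vary without changing the type of `f`.
  record Distinct (f : X → Y) (T : X → Set) : Set where
    field
      chosen    : ∀ {x} → T x → f x ∈ˡ L x
      injective : ∀ {x y} → T x → T y → f x ≡ f y → x ≡ y

  open Distinct

  update : (X → Y) → X → Y → X → Y
  update g x b z with z ≟ˣ x
  ... | yes _ = b
  ... | no _  = g z

  update-≢ : ∀ g x b {z} → z ≢ x → update g x b z ≡ g z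
  update-≢ g x b {z} z≢x with z ≟ˣ x
  ... | yes z≡x = contradiction z≡x z≢x
  ... | no _    = refl

  -- The old value at `x` is discarded, so only the other members of `T′` must avoid `b`. Allowing
  -- `T′` inside `T` lets the former owner of `b` be dropped at the same time.
  update-distinct : ∀ {g x b} {T T′ : X → Set} → Distinct g (λ y → T y × y ≢ x) → b ∈ˡ L x →
    (∀ {z} → T′ z → T z) → (∀ {z} → T′ z → z ≢ x → g z ≢ b) → Distinct (update g x b) T′
  update-distinct {g} {x} {b} {T} {T′} dg b∈ T′⇒T fresh = record { chosen = chosen′ ; injective = injective′ }
    where
    chosen′ : ∀ {z} → T′ z → update g x b z ∈ˡ L z
    chosen′ {z} Tz with z ≟ˣ x
    ... | yes refl = b∈
    ... | no z≢x   = chosen dg (T′⇒T Tz , z≢x)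
    injective′ : ∀ {z w} → T′ z → T′ w → update g x b z ≡ update g x b w → z ≡ w
    injective′ {z} {w} Tz Tw eq with z ≟ˣ x | w ≟ˣ x
    ... | yes refl | yes refl = refl
    ... | yes refl | no w≢x   = contradiction (sym eq) (fresh Tw w≢x)
    ... | no z≢x   | yes refl = contradiction eq (fresh Tz z≢x)
    ... | no z≢x   | no w≢x   = injective dg (T′⇒T Tz , z≢x) (T′⇒T Tw , w≢x) eq

  -- Double counting of incidences: each list contributes at least `t`, each value lies in at most
  -- `t` of the lists, and there is one more list than values.
  deficient⇒⊥ : (∀ xs → Unique xs → ∀ b → count (λ x → b ∈ʸ? L x) xs ≤ t) →
    ∀ xs ys → Unique xs → length xs ≡ suc (length ys) → ¬ (∀ {x} → x ∈ˡ xs → ∀ {b} → b ∈ˡ L x → b ∈ˡ ys)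
  deficient⇒⊥ count≤t xs ys uxs len L⊆ys = <⇒≱ (+-monoˡ-≤ (length ys * t) 1≤t) (begin
    t + length ys * t                                     ≡⟨ cong (_* t) len ⟨
    length xs * t                                         ≤⟨ sum-map-lower _ t xs (λ {x} x∈ → ≤-trans (t≤∣L∣ x) (L⊆ys-count x∈)) ⟩
    sum (map (λ x → count (λ b → b ∈ʸ? L x) ys) xs)       ≡⟨ sum-swap (λ x b → indicator (b ∈ʸ? L x)) xs ys ⟩
    sum (map (λ b → count (λ x → b ∈ʸ? L x) xs) ys)       ≤⟨ sum-map-upper _ t ys (count≤t xs uxs) ⟩
    length ys * t                                         ∎)
    where
    open ≤-Reasoning
    L⊆ys-count : ∀ {x} → x ∈ˡ xs → length (L x) ≤ count (λ b → b ∈ʸ? L x) ys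
    L⊆ys-count {x} x∈ = begin
      length (L x)                            ≤⟨ unique-⊆⇒length≤ (L-unique x) (λ b∈ → ∈-filter⁺ (_∈ʸ? L x) (L⊆ys x∈ b∈) b∈) ⟩
      length (filter (_∈ʸ? L x) ys)           ≡⟨ count≡length-filter (_∈ʸ? L x) ys ⟨
      count (λ b → b ∈ʸ? L x) ys              ∎

  -- The set xs of left vertices reachable from u by alternating paths: each x ∈ xs can be exposed
  -- instead of u by some g, which matches the rest of xs into ys and agrees with f off xs.
  record Alternating (f : X → Y) (T xs : List X) (ys : List Y) : Set where
    field
      reach⊆T   : ∀ {x} → x ∈ˡ xs → x ∈ˡ T
      unique    : Unique xs
      length≡   : length xs ≡ suc (length ys)
      exposing  : ∀ {x} → x ∈ˡ xs → ∃ λ g → Distinct g (λ y → y ∈ˡ T × y ≢ x)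
                    × (∀ {y} → y ∈ˡ T → ¬ y ∈ˡ xs → g y ≡ f y)
                    × (∀ {y} → y ∈ˡ xs → y ≢ x → g y ∈ˡ ys)

  open Alternating

  module _ (count≤t : ∀ xs → Unique xs → ∀ b → count (λ x → b ∈ʸ? L x) xs ≤ t) where

    augment : ∀ k {f T} xs ys → Alternating f T xs ys → length T ≤ k + length xs → ∃ λ g → Distinct g (_∈ˡ T)
    augment k {f} {T} xs ys alt len
      with All.all? (λ x → All.all? (_∈ʸ? ys) (L x)) xs
    ... | yes all∈ = contradiction (λ {x} x∈ {b} b∈ → All.lookup (All.lookup all∈ x∈) b∈)
                       (deficient⇒⊥ count≤t xs ys (unique alt) (length≡ alt))
    ... | no ¬all∈
      with x , x∈xs , ¬L⊆ys ← find (¬All⇒Any¬ (λ x → All.all? (_∈ʸ? ys) (L x)) xs ¬all∈)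
      with b , b∈Lx , b∉ys ← find (¬All⇒Any¬ (_∈ʸ? ys) (L x) ¬L⊆ys)
      with g , dg , g≡f , g∈ys ← exposing alt x∈xs
      with Any.any? (λ y → ¬? (y ≟ˣ x) ×-dec (g y ≟ʸ b)) T
    ...   | no free = update g x b , update-distinct dg b∈Lx (λ z∈ → z∈)
                        (λ z∈T z≢x gz≡b → free (lose z∈T (z≢x , gz≡b)))
    ...   | yes taken
      with y , y∈T , y≢x , refl ← find taken
      = continue k len
      where
      y∉xs : ¬ y ∈ˡ xs
      y∉xs y∈xs = b∉ys (g∈ys y∈xs y≢x)

      grown : Alternating f T (y ∷ xs) (g y ∷ ys)
      reach⊆T grown (here refl) = y∈T
      reach⊆T grown (there z∈)  = reach⊆T alt z∈
      unique grown = All.tabulate (λ z∈ y≡z → y∉xs (subst (_∈ˡ xs) (sym y≡z) z∈)) ∷ unique alt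
      length≡ grown = cong suc (length≡ alt)
      -- To expose `y`, its value `g y`, which is `b`, is handed to the vertex `x` exposed under
      -- `g`.
      exposing grown (here refl) =
        update g x (g y) ,
        update-distinct dg b∈Lx proj₁ (λ (z∈T , z≢y) z≢x gz≡gy → z≢y (injective dg (z∈T , z≢x) (y∈T , y≢x) gz≡gy)) ,
        (λ z∈T z∉ → trans (update-≢ g x (g y) (λ z≡x → z∉ (there (subst (_∈ˡ xs) (sym z≡x) x∈xs)))) (g≡f z∈T (λ z∈ → z∉ (there z∈)))) ,
        inReach
        where
        inReach : ∀ {z} → z ∈ˡ y ∷ xs → z ≢ y → update g x (g y) z ∈ˡ g y ∷ ys
        inReach (here z≡y) z≢y = contradiction z≡y z≢y
        inReach {z} (there z∈) z≢y with z ≟ˣ x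
        ... | yes _  = here refl
        ... | no z≢x = there (g∈ys z∈ z≢x)
      exposing grown (there z∈) with exposing alt z∈
      ... | h , dh , h≡f , h∈ys = h , dh , (λ w∈T w∉ → h≡f w∈T (λ w∈ → w∉ (there w∈))) , inReach
        where
        inReach : ∀ {w} → w ∈ˡ y ∷ xs → w ≢ _ → h w ∈ˡ g y ∷ ys
        -- `y` lay off `xs`, where `h` and `g` both agree with `f`; so `h y` is the newly added
        -- value.
        inReach (here refl) _    = here (trans (h≡f y∈T y∉xs) (sym (g≡f y∈T y∉xs)))
        inReach (there w∈)  w≢ = there (h∈ys w∈ w≢)

      continue : ∀ k → length T ≤ k + length xs → ∃ λ g → Distinct g (_∈ˡ T)
      continue zero    len = contradiction len (<⇒≱ (unique-⊆⇒length≤ (unique grown) (reach⊆T grown)))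
      continue (suc k) len = augment k (y ∷ xs) (g y ∷ ys) grown (≤-trans len (≤-reflexive (sym (+-suc k (length xs)))))

    transversal : ∀ xs → Unique xs → ∃ λ f → Distinct f (_∈ˡ xs)
    transversal [] [] = first , record { chosen = λ () ; injective = λ () }
      where
      -- An arbitrary function for the empty domain; it exists because `1≤t` makes every `L x`
      -- nonempty.
      first : X → Y
      first x with L x | t≤∣L∣ x
      ... | []    | t≤0 = contradiction (≤-trans 1≤t t≤0) λ ()
      ... | b ∷ _ | _   = b
    transversal (u ∷ xs) (u≢ ∷ uxs) with transversal xs uxs
    -- The unmatched `u` alone is the initial alternating tree, as `f` matches all the others.
    ... | f , df = augment (length (u ∷ xs)) (u ∷ []) [] start (m≤m+n _ _)
      where
      tail : ∀ {y} → y ∈ˡ u ∷ xs × y ≢ u → y ∈ˡ xs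
      tail (here y≡u , y≢u) = contradiction y≡u y≢u
      tail (there y∈ , _)   = y∈
      start : Alternating f (u ∷ xs) (u ∷ []) []
      start = record
        { reach⊆T  = λ { (here refl) → here refl }
        ; unique   = [] ∷ []
        ; length≡  = refl
        ; exposing = λ { (here refl) → f
            , record { chosen = λ y∈ → chosen df (tail y∈) ; injective = λ y∈ z∈ → injective df (tail y∈) (tail z∈) }
            , (λ _ _ → refl)
            , λ { (here y≡u) y≢u → contradiction y≡u y≢u } }
        }

-- Non-adjacent pairs spanning few vertices

module _ (2≤n : 2 ≤ n) (G : Fin k → Graph n) (O : ∀ i → Obstruction (G i)) where

  open module Obs i = Obstruction (O i)

  Contains : Subset n → Fin k → Set
  Contains W i = ∃₂ λ a b → a ∈ W × b ∈ W × NonAdj (G i) a b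

  -- The marked vertex `y` is where the next pair can be attached; one end of that pair is then
  -- already in `W`, so each colour costs at most one vertex.
  Cover : List (Fin k) → Fin n → Set
  Cover is y = ∃ λ W → y ∈ W × ∣ W ∣ ≤ suc (length is) × (∀ {i} → i ∈ˡ is → Contains W i)

  -- The mark may stay at `x` or move to `z`; `cover` needs both, since the vertex to be reached can
  -- be either end of the new pair.
  attach : ∀ {i is x z} → Cover is x → NonAdj (G i) x z → Cover (i ∷ is) x × Cover (i ∷ is) z
  attach {i} {is} {x} {z} (W , x∈W , ∣W∣≤ , contains) xz = (W⁺ , x∈W⁺ , ∣W⁺∣≤ , contains⁺) , (W⁺ , z∈W⁺ , ∣W⁺∣≤ , contains⁺)
    where
    W⁺ = W ∪ ⁅ z ⁆
    x∈W⁺ = x∈p∪q⁺ (inj₁ x∈W)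
    z∈W⁺ : z ∈ W⁺
    z∈W⁺ = x∈p∪q⁺ (inj₂ (x∈⁅x⁆ z))
    ∣W⁺∣≤ : ∣ W⁺ ∣ ≤ 2 + length is
    ∣W⁺∣≤ = begin
      ∣ W ∪ ⁅ z ⁆ ∣       ≤⟨ ∣p∪q∣≤∣p∣+∣q∣ W ⁅ z ⁆ ⟩
      ∣ W ∣ + ∣ ⁅ z ⁆ ∣   ≡⟨ cong (∣ W ∣ +_) (∣⁅x⁆∣≡1 z) ⟩
      ∣ W ∣ + 1           ≡⟨ +-comm ∣ W ∣ 1 ⟩
      suc ∣ W ∣           ≤⟨ s≤s ∣W∣≤ ⟩
      2 + length is       ∎
      where open ≤-Reasoning
    contains⁺ : ∀ {j} → j ∈ˡ i ∷ is → Contains W⁺ j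
    contains⁺ (here refl) = x , z , x∈W⁺ , z∈W⁺ , xz
    contains⁺ (there j∈) with contains j∈
    ... | a , b , a∈ , b∈ , ab = a , b , x∈p∪q⁺ (inj₁ a∈) , x∈p∪q⁺ (inj₁ b∈) , ab

  NonAdj-sym : ∀ {i x y} → NonAdj (G i) x y → NonAdj (G i) y x
  NonAdj-sym {i} (x≢y , y∉) = (λ y≡x → x≢y (sym y≡x)) , λ x∈ → y∉ (N-sym (G i) x∈)

  outside-N : ∀ i x (q : Subset n) → deg (G i) x + ∣ q ∣ < n → ∃ λ z → z ∉ N (G i) x × z ∉ q
  outside-N i x q small with ∣p∣<n⇒∃∉ (N (G i) x ∪ q) (≤-trans (s≤s (∣p∪q∣≤∣p∣+∣q∣ (N (G i) x) q)) small)
  ... | z , z∉ = z , (λ z∈ → z∉ (x∈p∪q⁺ (inj₁ z∈))) , (λ z∈ → z∉ (x∈p∪q⁺ (inj₂ z∈)))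

  bound+1<n : ∀ i → bound i + 1 < n
  bound+1<n i with bound i | 2bound<n i
  ... | zero  | _ = 2≤n
  ... | suc d | h = ≤-trans (s≤s (+-monoʳ-≤ (suc d) (s≤s z≤n))) h

  -- If D i ⊈ Q, a vertex x ∈ D i ∖ Q attaches to each of its non-neighbours. Otherwise D i = Q by
  -- cardinality, and every vertex of D i has a non-neighbour outside Q, as its degree plus ∣ Q ∣ is
  -- less than n. Either way the new exceptional set is the neighbourhood of a vertex of D i.
  cover : ∀ is → AllPairs (λ i j → bound j ≤ bound i) is →
    ∃ λ Q → (∀ d → All (λ i → bound i ≤ d) is → ∣ Q ∣ ≤ d) × (∀ y → y ∉ Q → Cover is y)
  cover [] _ = ⊥ , (λ _ _ → ≤-trans (≤-reflexive (∣⊥∣≡0 n)) z≤n) ,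
    λ y _ → ⁅ y ⁆ , x∈⁅x⁆ y , ≤-reflexive (∣⁅x⁆∣≡1 y) , λ ()
  cover (i ∷ is) (≤i ∷ sorted) with cover is sorted
  ... | Q , ∣Q∣≤ , covered with any? (λ x → (x ∈? D i) ×-dec ¬? (x ∈? Q))
  ...   | yes (x , x∈D , x∉Q) = N (G i) x , (λ { d (i≤d ∷ _) → ≤-trans (deg≤bound i x∈D) i≤d }) , covered⁺
    where
    covered⁺ : ∀ y → y ∉ N (G i) x → Cover (i ∷ is) y
    covered⁺ y y∉ with x ≟ y
    ... | no x≢y   = proj₂ (attach (covered x x∉Q) (x≢y , y∉))
    -- The vertex to be reached is `x` itself, so a partner `z` is needed; the degree bound leaves a
    -- non-neighbour other than `x`.
    ... | yes refl with outside-N i x ⁅ x ⁆ (≤-trans (s≤s (+-mono-≤ (deg≤bound i x∈D) (≤-reflexive (∣⁅x⁆∣≡1 x)))) (bound+1<n i))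
    ...   | z , z∉N , z∉x = proj₁ (attach (covered x x∉Q) ((λ { refl → z∉x (x∈⁅x⁆ x) }) , z∉N))
  ...   | no D⊆Q′ = N (G i) x , (λ { d (i≤d ∷ _) → ≤-trans (deg≤bound i x∈D) i≤d }) , covered⁺
    where
    x = proj₁ (nonempty i)
    x∈D = proj₂ (nonempty i)
    D⊆Q : D i ⊆ Q
    D⊆Q {z} z∈D with z ∈? Q
    ... | yes z∈Q = z∈Q
    ... | no z∉Q  = contradiction (z , z∈D , z∉Q) D⊆Q′
    ∣Q∣≤bound : ∣ Q ∣ ≤ bound i
    ∣Q∣≤bound = ∣Q∣≤ (bound i) ≤i
    covered⁺ : ∀ y → y ∉ N (G i) x → Cover (i ∷ is) y
    covered⁺ y y∉ with y ∈? Q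
    -- Here `y` is already covered. It differs from `x`, which lies in `Q`, and is not adjacent to
    -- it, so `x` serves as its partner.
    ... | no y∉Q = proj₁ (attach (covered y y∉Q) (NonAdj-sym ((λ { refl → y∉Q (D⊆Q x∈D) }) , y∉)))
    ... | yes y∈Q with outside-N i y Q (≤-trans (s≤s (+-mono-≤ (deg≤bound i (⊆∧∣≥∣⇒⊇ D⊆Q (≤-trans ∣Q∣≤bound (bound≤∣D∣ i)) y∈Q)) ∣Q∣≤bound)) (2bound<n i))
    ...   | z , z∉N , z∉Q = proj₂ (attach (covered z z∉Q) (NonAdj-sym ((λ { refl → z∉Q y∈Q }) , z∉N)))

  smallTransversal : ∃ λ W → ∣ W ∣ ≤ suc k × (∀ i → Contains W i)
  smallTransversal with cover is sorted
    where
    -- The list decreases in `bound`: `cover` treats the tail first, so colours are added in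
    -- increasing order of `bound`.
    open Sort (On.decTotalOrder (Flip.decTotalOrder ≤-decTotalOrder) bound)
    is = sort (allFin k)
    sorted : AllPairs (λ i j → bound j ≤ bound i) is
    sorted = Linked⇒AllPairs (λ {i} {j} {l} ij jl → ≤-trans jl ij) (sort-↗ (allFin k))
  ... | Q , ∣Q∣≤ , covered with ∣p∣<n⇒∃∉ Q (subst (suc ∣ Q ∣ ≤_) (m+[n∸m]≡n (≤-trans (n≤1+n 1) 2≤n)) (s≤s (∣Q∣≤ (n ∸ 1) (All.tabulate (λ {i} _ → bound≤ i)))))
    where
    bound≤ : ∀ i → bound i ≤ n ∸ 1
    bound≤ i = ≤-trans (m≤m+n (bound i) (bound i)) (∸-monoˡ-≤ 1 (2bound<n i))
  ...   | y , y∉Q with covered y y∉Q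
  ...     | W , _ , ∣W∣≤ , contains = W ,
    subst (λ m → ∣ W ∣ ≤ suc m) (trans (↭-length (sort-↭ (allFin k))) (length-allFin k)) ∣W∣≤ ,
    λ i → contains (∈-resp-↭ (↭-sym (sort-↭ (allFin k))) (∈-allFin i))
    where open Sort (On.decTotalOrder (Flip.decTotalOrder ≤-decTotalOrder) bound)

-- Edges of one colour through a pair

module _ (χ : Colouring n r k) where

  Joins : Fin k → Fin n → Fin n → Subset n → Set
  Joins i x y e = x ∈ e × y ∈ e × Σ (∣ e ∣ ≡ r) λ p → χ (e , p) ≡ i

  Joins? : ∀ i x y e → Dec (Joins i x y e)
  Joins? i x y e = (x ∈? e) ×-dec ((y ∈? e) ×-dec coloured?)
    where
    coloured? : Dec (Σ (∣ e ∣ ≡ r) λ p → χ (e , p) ≡ i)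
    coloured? with ∣ e ∣ Data.Nat.≟ r
    ... | no ≢r = no λ (p , _) → ≢r p
    ... | yes p with χ (e , p) ≟ i
    ...   | yes eq = yes (p , eq)
    -- The colour depends on a size proof as well; equality proofs on natural numbers are unique, so
    -- another `q` gives the same colour.
    ...   | no ≢i  = no λ (q , eq) → ≢i (trans (cong (λ p → χ (e , p)) (≡-irrelevant p q)) eq)

  edgesThrough : Fin k → Fin n → Fin n → List (Subset n)
  edgesThrough i x y = filter (Joins? i x y) (subsets n)

  edgesThrough-unique : ∀ i x y → Unique (edgesThrough i x y)
  edgesThrough-unique i x y = Unique.filter⁺ (Joins? i x y) (subsets-unique n)

  ∈-edgesThrough⁺ : ∀ {i x y e} → Joins i x y e → e ∈ˡ edgesThrough i x y
  ∈-edgesThrough⁺ {i} {x} {y} {e} = ∈-filter⁺ (Joins? i x y) (∈-subsets e)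

  ∈-edgesThrough⁻ : ∀ {i x y e} → e ∈ˡ edgesThrough i x y → Joins i x y e
  ∈-edgesThrough⁻ {i} {x} {y} e∈ = proj₂ (∈-filter⁻ (Joins? i x y) {xs = subsets n} e∈)

  edgesThrough-sym : ∀ i x y → length (edgesThrough i x y) ≤ length (edgesThrough i y x)
  edgesThrough-sym i x y = unique-⊆⇒length≤ (edgesThrough-unique i x y) λ e∈ →
    let x∈e , y∈e , coloured = ∈-edgesThrough⁻ e∈ in ∈-edgesThrough⁺ (y∈e , x∈e , coloured)

  module _ (t : ℕ) (i : Fin k) where

    Rich : Fin n → Fin n → Set
    Rich x y = x ≢ y × t ≤ length (edgesThrough i x y)

    Rich? : ∀ x y → Dec (Rich x y)
    Rich? x y = ¬? (x ≟ y) ×-dec (t ≤? length (edgesThrough i x y))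

    richGraph : Graph n
    richGraph = record
      { N        = λ x → comprehension (Rich? x)
      ; N-sym    = λ {x} {y} y∈ → let x≢y , t≤ = ∈-comprehension⁻ (Rich? x) y∈ in
                     ∈-comprehension⁺ (Rich? y) ((λ y≡x → x≢y (sym y≡x)) , ≤-trans t≤ (edgesThrough-sym i x y))
      ; N-irrefl = λ {x} x∈ → proj₁ (∈-comprehension⁻ (Rich? x) x∈) refl
      }

    Adj-rich⁻ : ∀ {x y} → Adj richGraph x y → t ≤ length (edgesThrough i x y)
    Adj-rich⁻ {x} xy = proj₂ (∈-comprehension⁻ (Rich? x) xy)

    NonAdj-rich⁻ : ∀ {x y} → NonAdj richGraph x y → length (edgesThrough i x y) < t
    NonAdj-rich⁻ {x} {y} (x≢y , y∉) = ≰⇒> λ t≤ → y∉ (∈-comprehension⁺ (Rich? x) (x≢y , t≤))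

  -- Each of the r-sets W ∪ {z} contains the pair chosen for its own colour.
  fewExtensions : (t : ℕ) (W : Subset n) → suc ∣ W ∣ ≡ r →
    (∀ i → ∃₂ λ a b → a ∈ W × b ∈ W × length (edgesThrough i a b) ≤ t) → n ∸ ∣ W ∣ ≤ k * t
  fewExtensions t W ∣W∣≡ poor = begin
    n ∸ ∣ W ∣                                         ≡⟨ ∣∁p∣≡n∸∣p∣ W ⟨
    ∣ ∁ W ∣                                           ≡⟨ length-elements (∁ W) ⟨
    length (elements (∁ W))                           ≡⟨ length-map ext (elements (∁ W)) ⟨
    length (map ext (elements (∁ W)))                 ≤⟨ unique-⊆⇒length≤ (unique-map ext-injective (elements-unique (∁ W))) ext∈ ⟩
    length (concatMap through (allFin k))             ≤⟨ length-concatMap-≤ through t (allFin k) (λ i → proj₂ (proj₂ (proj₂ (proj₂ (poor i))))) ⟩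
    length (allFin k) * t                             ≡⟨ cong (_* t) (length-allFin k) ⟩
    k * t                                             ∎
    where
    open ≤-Reasoning
    ext : Fin n → Subset n
    ext z = W ∪ ⁅ z ⁆
    through : Fin k → List (Subset n)
    through i = edgesThrough i (proj₁ (poor i)) (proj₁ (proj₂ (poor i)))
    ∉W : ∀ {z} → z ∈ˡ elements (∁ W) → z ∉ W
    ∉W z∈ = x∈∁p⇒x∉p (∈-elements⁻ (∁ W) z∈)
    ext-injective : ∀ {x y} → x ∈ˡ elements (∁ W) → y ∈ˡ elements (∁ W) → ext x ≡ ext y → x ≡ y
    ext-injective {x} {y} x∈ y∈ eq with x∈p∪q⁻ W ⁅ y ⁆ (subst (x ∈_) eq (x∈p∪q⁺ (inj₂ (x∈⁅x⁆ x))))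
    ... | inj₁ x∈W = contradiction x∈W (∉W x∈)
    ... | inj₂ x∈y = x∈⁅y⁆⇒x≡y y x∈y
    ext∈ : ∀ {e} → e ∈ˡ map ext (elements (∁ W)) → e ∈ˡ concatMap through (allFin k)
    ext∈ e∈ with ∈-map⁻ ext e∈
    ... | z , z∈ , refl = ∈-concatMap⁺ through (lose (∈-allFin i) (∈-edgesThrough⁺ (p⊆p∪q ⁅ z ⁆ a∈ , p⊆p∪q ⁅ z ⁆ b∈ , size , refl)))
      where
      size : ∣ ext z ∣ ≡ r
      size = trans (∣p∪⁅x⁆∣≡1+∣p∣ W (∉W z∈)) ∣W∣≡
      i = χ (ext z , size)
      a∈ = proj₁ (proj₂ (proj₂ (poor i)))
      b∈ = proj₁ (proj₂ (proj₂ (proj₂ (poor i))))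

-- From Hamiltonian cycles to Berge cycles

toℕ-next : (j : Fin (suc n)) → toℕ (next j) ≡ suc (toℕ j) % suc n
toℕ-next {n} j = toℕ-fromℕ< (m%n<n (suc (toℕ j)) (suc n))

toℕ-next-last : (j : Fin n) → suc (toℕ j) ≡ n → toℕ (next j) ≡ 0
toℕ-next-last {suc n} j eq = trans (toℕ-next j) (trans (cong (_% suc n) eq) (n%n≡0 (suc n)))

toℕ-next-step : (j : Fin n) → suc (toℕ j) < n → toℕ (next j) ≡ suc (toℕ j)
toℕ-next-step {suc n} j lt = trans (toℕ-next j) (m<n⇒m%n≡m lt)

-- Iterating `next` adds 1 modulo the size, so every `j` is reached from `j₀`. The step count
-- includes one full turn to keep the subtraction from truncating.
next-closed⇒all : {P : Fin n → Set} → (∀ j → P j → P (next j)) → ∃ P → ∀ j → P j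
next-closed⇒all {suc n} {P} P-next (j₀ , Pj₀) j = subst P f≡j (climb (toℕ j + suc n ∸ toℕ j₀))
  where
  f : ℕ → Fin (suc n)
  f m = fromℕ< (m%n<n m (suc n))
  toℕ-f : ∀ m → toℕ (f m) ≡ m % suc n
  toℕ-f m = toℕ-fromℕ< (m%n<n m (suc n))
  next-f : ∀ m → next (f m) ≡ f (suc m)
  next-f m = toℕ-injective (begin
    toℕ (next (f m))                             ≡⟨ toℕ-next (f m) ⟩
    suc (toℕ (f m)) % suc n                      ≡⟨ cong (λ x → suc x % suc n) (toℕ-f m) ⟩
    (1 + m % suc n) % suc n                      ≡⟨ %-distribˡ-+ 1 (m % suc n) (suc n) ⟩
    (1 % suc n + m % suc n % suc n) % suc n      ≡⟨ cong (λ x → (1 % suc n + x) % suc n) (m%n%n≡m%n m (suc n)) ⟩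
    (1 % suc n + m % suc n) % suc n              ≡⟨ %-distribˡ-+ 1 m (suc n) ⟨
    suc m % suc n                                ≡⟨ toℕ-f (suc m) ⟨
    toℕ (f (suc m))                              ∎)
    where open ≡-Reasoning
  f-toℕ : ∀ i → f (toℕ i) ≡ i
  f-toℕ i = toℕ-injective (trans (toℕ-f (toℕ i)) (m<n⇒m%n≡m (toℕ<n i)))
  climb : ∀ m → P (f (m + toℕ j₀))
  climb zero    = subst P (sym (f-toℕ j₀)) Pj₀
  climb (suc m) = subst P (next-f (m + toℕ j₀)) (P-next _ (climb m))
  f≡j : f (toℕ j + suc n ∸ toℕ j₀ + toℕ j₀) ≡ j
  f≡j = toℕ-injective (begin
    toℕ (f (toℕ j + suc n ∸ toℕ j₀ + toℕ j₀))    ≡⟨ cong (λ m → toℕ (f m)) (m∸n+n≡m (≤-trans (<⇒≤ (toℕ<n j₀)) (m≤n+m (suc n) (toℕ j)))) ⟩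
    toℕ (f (toℕ j + suc n))                      ≡⟨ toℕ-f (toℕ j + suc n) ⟩
    (toℕ j + suc n) % suc n                      ≡⟨ [m+n]%n≡m%n (toℕ j) (suc n) ⟩
    toℕ j % suc n                                ≡⟨ m<n⇒m%n≡m (toℕ<n j) ⟩
    toℕ j                                        ∎)
    where open ≡-Reasoning

module _ {A : Set} {R : A → A → Set} where

  path-lookup-first : ∀ {a l b} → Path R a l b → (j : Fin (length l)) → toℕ j ≡ 0 → lookup l j ≡ a
  path-lookup-first [ _ ]   zero _ = refl
  path-lookup-first (_ ∷ _) zero _ = refl

  path-lookup-last : ∀ {a l b} → Path R a l b → (j : Fin (length l)) → suc (toℕ j) ≡ length l → lookup l j ≡ b
  path-lookup-last [ _ ]         zero    _  = refl
  path-lookup-last (_ ∷ [ _ ])   zero    ()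
  path-lookup-last (_ ∷ (_ ∷ _)) zero    ()
  path-lookup-last (_ ∷ p)       (suc j) eq = path-lookup-last p j (cong (_∸ 1) eq)

  path-lookup-step : ∀ {a l b} → Path R a l b → (i j : Fin (length l)) → toℕ j ≡ suc (toℕ i) → R (lookup l i) (lookup l j)
  path-lookup-step [ _ ]   zero    zero    ()
  path-lookup-step (r ∷ p) zero    (suc j) eq = subst (R _) (sym (path-lookup-first p j (cong (_∸ 1) eq))) r
  path-lookup-step (r ∷ p) (suc i) (suc j) eq = path-lookup-step p i j (cong (_∸ 1) eq)

-- The core is the lookup by position in the vertex list. It is injective because that list, a
-- permutation of `allFin n`, has no repetitions.
HamCycle⇒core : {G : Graph n} → HamCycle G → Σ (Permutation′ n) λ π → ∀ j → Adj G (π ⟨$⟩ʳ j) (π ⟨$⟩ʳ next j)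
HamCycle⇒core {n} {G} C = permutation to from to-from (λ j → to-injective (to-from (to j))) , adjacent
  where
  open HamCycle C
  n≡ : n ≡ length vertices
  n≡ = trans (sym (length-allFin n)) (sym (↭-length spanning))
  to : Fin n → Fin n
  to j = lookup vertices (cast n≡ j)
  member : ∀ v → v ∈ˡ vertices
  member v = ∈-resp-↭ (↭-sym spanning) (∈-allFin v)
  from : Fin n → Fin n
  from v = cast (sym n≡) (index (member v))
  to-from : ∀ v → to (from v) ≡ v
  to-from v = trans (cong (lookup vertices) (cast-involutive n≡ (sym n≡) (index (member v)))) (sym (lookup-index (member v)))
  to-injective : ∀ {i j} → to i ≡ to j → i ≡ j
  to-injective {i} {j} eq = toℕ-injective (begin
    toℕ i           ≡⟨ toℕ-cast n≡ i ⟨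
    toℕ (cast n≡ i) ≡⟨ cong toℕ (unique-lookup-injective (unique-resp-↭ (↭-sym spanning) (Unique.allFin⁺ n)) _ _ eq) ⟩
    toℕ (cast n≡ j) ≡⟨ toℕ-cast n≡ j ⟩
    toℕ j           ∎)
    where open ≡-Reasoning
  adjacent : ∀ j → Adj G (to j) (to (next j))
  -- `next` wraps around at the last position only, where `closed` supplies the adjacency.
  adjacent j with m≤n⇒m<n∨m≡n (toℕ<n j)
  ... | inj₁ lt = path-lookup-step path _ _
    (trans (toℕ-cast n≡ (next j)) (trans (toℕ-next-step j lt) (cong suc (sym (toℕ-cast n≡ j)))))
  ... | inj₂ eq = subst₂ (Adj G)
    (sym (path-lookup-last path _ (trans (cong suc (toℕ-cast n≡ j)) (trans eq n≡))))
    (sym (path-lookup-first path _ (trans (toℕ-cast n≡ (next j)) (toℕ-next-last j eq))))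
    closed

∣preimage∣≤ : (π : Permutation′ n) (e : Subset n) → ∣ comprehension (λ j → (π ⟨$⟩ʳ j) ∈? e) ∣ ≤ ∣ e ∣
∣preimage∣≤ π e = begin
  ∣ J ∣                                    ≡⟨ length-elements J ⟨
  length (elements J)                      ≡⟨ length-map (π ⟨$⟩ʳ_) (elements J) ⟨
  length (map (π ⟨$⟩ʳ_) (elements J))      ≤⟨ unique-⊆⇒length≤ (Unique.map⁺ π-injective (elements-unique J)) image⊆e ⟩
  length (elements e)                      ≡⟨ length-elements e ⟩
  ∣ e ∣                                    ∎
  where
  open ≤-Reasoning
  inside? = λ j → (π ⟨$⟩ʳ j) ∈? e
  J = comprehension inside?
  π-injective : ∀ {i j} → π ⟨$⟩ʳ i ≡ π ⟨$⟩ʳ j → i ≡ j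
  π-injective eq = trans (sym (inverseˡ π)) (trans (cong (π ⟨$⟩ˡ_) eq) (inverseˡ π))
  image⊆e : ∀ {x} → x ∈ˡ map (π ⟨$⟩ʳ_) (elements J) → x ∈ˡ elements e
  image⊆e x∈ with ∈-map⁻ (π ⟨$⟩ʳ_) x∈
  ... | _ , j∈ , refl = ∈-elements⁺ (∈-comprehension⁻ inside? (∈-elements⁻ J j∈))

-- The cyclic sequence leaves a proper nonempty subset at least once.
consecutive-count : (π : Permutation′ n) (e : Subset n) → 1 ≤ ∣ e ∣ → ∣ e ∣ < n →
  ∀ {J} → (∀ {j} → j ∈ J → π ⟨$⟩ʳ j ∈ e × π ⟨$⟩ʳ next j ∈ e) → ∣ J ∣ < ∣ e ∣
consecutive-count {n} π e 1≤∣e∣ ∣e∣<n {J} both∈ with any? (λ j → ((π ⟨$⟩ʳ j) ∈? e) ×-dec ¬? (j ∈? J))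
... | yes (j , πj∈e , j∉J) = ≤-trans
  (p⊂q⇒∣p∣<∣q∣ ((λ j∈J → ∈-comprehension⁺ inside? (proj₁ (both∈ j∈J))) , j , ∈-comprehension⁺ inside? πj∈e , j∉J))
  (∣preimage∣≤ π e)
  where inside? = λ j → (π ⟨$⟩ʳ j) ∈? e
-- Otherwise membership in `e` passes from each position to the next, so `e` would contain all `n`
-- vertices.
... | no none = contradiction ∣e∣<n (≤⇒≯ (begin
    n                                       ≡⟨ ∣⊤∣≡n n ⟨
    ∣ ⊤ {n} ∣                               ≤⟨ p⊆q⇒∣p∣≤∣q∣ {p = ⊤} (λ {j} _ → ∈-comprehension⁺ inside? (all∈ j)) ⟩
    ∣ comprehension inside? ∣               ≤⟨ ∣preimage∣≤ π e ⟩
    ∣ e ∣                                   ∎))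
  where
  open ≤-Reasoning
  inside? = λ j → (π ⟨$⟩ʳ j) ∈? e
  e-nonempty : Nonempty e
  e-nonempty with nonempty? e
  ... | yes x∈e = x∈e
  ... | no ∅    = contradiction (trans (cong ∣_∣ (Empty-unique ∅)) (∣⊥∣≡0 n)) (>⇒≢ 1≤∣e∣)
  step : ∀ j → π ⟨$⟩ʳ j ∈ e → π ⟨$⟩ʳ next j ∈ e
  step j πj∈e with j ∈? J
  ... | yes j∈J = proj₂ (both∈ j∈J)
  ... | no j∉J  = contradiction (j , πj∈e , j∉J) none
  all∈ : ∀ j → π ⟨$⟩ʳ j ∈ e
  all∈ = next-closed⇒all step (π ⟨$⟩ˡ proj₁ e-nonempty , subst (_∈ e) (sym (inverseʳ π)) (proj₂ e-nonempty))

-- Hall's argument matches positions with edges, for `t = r - 1`: adjacency gives each position at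
-- least `t` edges of colour `i`, and `consecutive-count` lets an edge serve at most `t` positions.
HamCycle⇒Berge : (χ : Colouring n r k) (t : ℕ) → 1 ≤ t → suc t ≡ r → r < n → (i : Fin k) →
  HamCycle (richGraph χ t i) → MonoHamBergeCycle χ
HamCycle⇒Berge {n} {r} {k} χ t 1≤t 1+t≡r r<n i C = record
  { colour        = i
  ; core          = π
  ; edges         = λ j → f j , proj₁ (proj₂ (proj₂ (joins j)))
  ; distinct      = λ {x} {y} → Distinct.injective f-distinct (∈-allFin x) (∈-allFin y)
  ; contains-this = λ j → proj₁ (joins j)
  ; contains-next = λ j → proj₁ (proj₂ (joins j))
  ; mono          = λ j → proj₂ (proj₂ (proj₂ (joins j)))
  }
  where
  π = proj₁ (HamCycle⇒core C)
  L : Fin n → List (Subset n)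
  L j = edgesThrough χ i (π ⟨$⟩ʳ j) (π ⟨$⟩ʳ next j)
  open Hall _≟_ _≟ˢ_ L (λ j → edgesThrough-unique χ i _ _) t 1≤t (λ j → Adj-rich⁻ χ t i (proj₂ (HamCycle⇒core C) j))
  open DecMembership _≟ˢ_ using () renaming (_∈?_ to _∈ˡ?_)
  count≤t : ∀ xs → Unique xs → ∀ e → count (λ j → e ∈ˡ? L j) xs ≤ t
  count≤t xs uxs e with ∣ e ∣ Data.Nat.≟ r
  ... | no ≢r = ≤-trans (≤-reflexive (count≡length-filter e∈? xs))
    (≤-trans (unique-⊆⇒length≤ {ys = []} (Unique.filter⁺ e∈? uxs)
      (λ j∈ → contradiction (proj₁ (proj₂ (proj₂ (∈-edgesThrough⁻ χ (proj₂ (∈-filter⁻ e∈? {xs = xs} j∈)))))) ≢r)) z≤n)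
    where e∈? = λ j → e ∈ˡ? L j
  ... | yes refl = ≤-pred (begin-strict
    count e∈? xs              ≡⟨ count≡length-filter e∈? xs ⟩
    length (filter e∈? xs)    ≤⟨ unique-⊆⇒length≤ (Unique.filter⁺ e∈? uxs) (λ j∈ → ∈-elements⁺ (∈-comprehension⁺ e∈? (proj₂ (∈-filter⁻ e∈? {xs = xs} j∈)))) ⟩
    length (elements J)       ≡⟨ length-elements J ⟩
    ∣ J ∣                     <⟨ consecutive-count π e (≤-trans (s≤s z≤n) (≤-reflexive 1+t≡r)) r<n both∈ ⟩
    ∣ e ∣                     ≡⟨ 1+t≡r ⟨
    suc t                     ∎)
    where
    open ≤-Reasoning
    e∈? = λ j → e ∈ˡ? L j
    J = comprehension e∈?
    both∈ : ∀ {j} → j ∈ J → π ⟨$⟩ʳ j ∈ e × π ⟨$⟩ʳ next j ∈ e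
    both∈ j∈ with ∈-edgesThrough⁻ χ (∈-comprehension⁻ e∈? j∈)
    ... | this , following , _ = this , following
  f = proj₁ (transversal count≤t (allFin n) (Unique.allFin⁺ n))
  f-distinct = proj₂ (transversal count≤t (allFin n) (Unique.allFin⁺ n))
  joins : ∀ j → Joins χ i (π ⟨$⟩ʳ j) (π ⟨$⟩ʳ next j) (f j)
  joins j = ∈-edgesThrough⁻ χ (Distinct.chosen f-distinct (∈-allFin j))

-- Arithmetic and conclusion of the argument

search : {P Q : Fin k → Set} → (∀ i → P i ⊎ Q i) → ∃ P ⊎ (∀ i → Q i)
search {zero}  _ = inj₂ λ ()
search {suc k} h with h zero | search (λ i → h (suc i))
... | inj₁ p | _             = inj₁ (zero , p)
... | inj₂ _ | inj₁ (i , p)  = inj₁ (suc i , p)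
... | inj₂ q | inj₂ qs       = inj₂ λ { zero → q ; (suc i) → qs i }

-- With `r = k + 2`, the bound on `n` splits as `k² + 1` plus `k + 1`: a set of `k + 1` vertices
-- leaves more than `k²` others. `expand` shows that the truncated subtraction loses nothing.
quadratic-bound : ∀ k n → ((2 + k) * (2 + k) + 4) ∸ 3 * (2 + k) ≤ n → suc (k * k) + suc k ≤ n
quadratic-bound k n = subst (_≤ n) (trans (cong (_∸ 3 * (2 + k)) expand) (m+n∸n≡m (suc (k * k) + suc k) (3 * (2 + k))))
  where
  open +-*-Solver
  expand : (2 + k) * (2 + k) + 4 ≡ suc (k * k) + suc k + 3 * (2 + k)
  expand = solve 1 (λ k → (con 2 :+ k) :* (con 2 :+ k) :+ con 4 :=
    con 1 :+ k :* k :+ (con 1 :+ k) :+ con 3 :* (con 2 :+ k)) refl k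

notAllObstructed : (χ : Colouring n (2 + k) k) → 2 ≤ n → suc (k * k) + suc k ≤ n →
  ¬ (∀ i → Obstruction (richGraph χ (suc k) i))
notAllObstructed {n} {k} χ 2≤n n-large O
  with W , ∣W∣≤ , contains ← smallTransversal 2≤n (richGraph χ (suc k)) O
  -- Size `k + 1` is one short of an edge, so each further vertex completes `W⁺` to an edge.
  with W⁺ , W⊆W⁺ , ∣W⁺∣≡ ← extend W (suc k) ∣W∣≤ (≤-trans (m≤n+m (suc k) (suc (k * k))) n-large)
  = <⇒≱ manyExtensions (fewExtensions χ k W⁺ (cong suc ∣W⁺∣≡) poor)
  where
  manyExtensions : k * k < n ∸ ∣ W⁺ ∣
  manyExtensions = subst (λ w → k * k < n ∸ w) (sym ∣W⁺∣≡) (m+n≤o⇒m≤o∸n (suc (k * k)) n-large)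
  poor : ∀ i → ∃₂ λ a b → a ∈ W⁺ × b ∈ W⁺ × length (edgesThrough χ i a b) ≤ k
  poor i with contains i
  ... | a , b , a∈ , b∈ , ab = a , b , W⊆W⁺ a∈ , W⊆W⁺ b∈ , ≤-pred (NonAdj-rich⁻ χ (suc k) i ab)

theorem2p3 : (r n : ℕ) → 3 ≤ r → (r * r + 4) ∸ (3 * r) ≤ n →
    (χ : Colouring n r (r ∸ 2)) → MonoHamBergeCycle χ
theorem2p3 (suc (suc k@(suc _))) n (s≤s (s≤s (s≤s _))) hyp χ = conclude (search λ i → HamCycle-or-Obstruction 3≤n (richGraph χ (suc k) i))
  where
  n-large : suc (k * k) + suc k ≤ n
  n-large = quadratic-bound k n hyp
  r<n : 2 + k < n
  -- Since `k` is at least 1, the summand `k² + 1` is at least 2.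
  r<n = ≤-trans (+-monoˡ-≤ (suc k) (s≤s (s≤s z≤n))) n-large
  3≤n : 3 ≤ n
  3≤n = ≤-trans (s≤s (s≤s (s≤s z≤n))) r<n
  conclude : ∃ (λ i → HamCycle (richGraph χ (suc k) i)) ⊎ (∀ i → Obstruction (richGraph χ (suc k) i)) → MonoHamBergeCycle χ
  conclude (inj₁ (i , C)) = HamCycle⇒Berge χ (suc k) (s≤s z≤n) refl r<n i C
  conclude (inj₂ O)       = contradiction O (notAllObstructed χ (<⇒≤ 3≤n) n-large)
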